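{- Let $(S\lhd P,\iota^S,\sigma^S,\mathrm{pr}^S)$ be a monadic container satisfying the (S3) property for some $s:S$ and $f:P\,s\to S$, such that there are two distinct positions $p,p':P\,s$, and let $(T\lhd Q,\iota^T,\sigma^T,\mathrm{pr}^T)$ be a monadic container. Assume there is a monadic container distributive law $(u_1,u_2,v_1,v_2)$ of $T\lhd Q$ over $S\lhd P$ (so that in particular $u_1:\prod_{s:S}(P\,s\to T)\to T$). Then $T\lhd Q$ cannot have more than one distinct constant shape, i.e. there do not exist constant shapes $t_0,t_1:T$ with $t_0\neq t_1$.
   Context: Work in intensional Martin-Löf type theory with function extensionality (e.g. cubical type theory); $\mathsf{Set}$ is the universe of h-sets, $\bot$ the empty type. $\lambda\_.x$ is a constant function and $(p,-):=\lambda p'.(p,p')$. Arguments in braces are implicit and are omitted when inferable. Equalities between elements of dependent types are heterogeneous: they hold over (up to transport along) the equalities listed before them on which their types depend. **Containers.** A container $S\lhd P$ is a type $S:\mathsf{Set}$ (shapes) with a family $P:S\to\mathsf{Set}$ (positions). **Monadic containers.** A monadic container $(S\lhd P,\iota,\sigma,\mathrm{pr})$ is a container $S\lhd P$ with - $\iota:S$, - $\sigma:\prod_{s:S}(P\,s\to S)\to S$, - $\mathrm{pr}:\prod_{\{s:S\}}\prod_{\{f:P\,s\to S\}}P\,(\sigma\,s\,f)\to\sum_{p:P\,s}P\,(f\,p)$, such that, writing $\mathrm{pr}_i:=\pi_i\circ\mathrm{pr}$, for all $s:S$, $f:P\,s\to S$, $g:(\sum_{p:P\,s}P\,(f\,p))\to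 S$ and positions $p$ of the appropriate type: - $\sigma\,\iota\,(\lambda\_.s)=s$ and $\mathrm{pr}_2\{\iota\}\{\lambda\_.s\}\,p=p$; - $\sigma\,s\,(\lambda\_.\iota)=s$ and $\mathrm{pr}_1\{s\}\{\lambda\_.\iota\}\,p=p$; - $\sigma\,s\,(\lambda p.\,\sigma\,(f\,p)\,(g\circ(p,-)))=\sigma\,(\sigma\,s\,f)\,(g\circ\mathrm{pr})$; - $\mathrm{pr}_1\{s\}\{h\}\,p=\mathrm{pr}_1\{s\}\{f\}\,(\mathrm{pr}_1\{\sigma\,s\,f\}\{g\circ\mathrm{pr}\}\,p)$; - $\mathrm{pr}_1\{f(\mathrm{pr}_1p)\}\{\lambda p'.g(\mathrm{pr}_1p,p')\}\,(\mathrm{pr}_2\{s\}\{h\}\,p)=\mathrm{pr}_2\{s\}\{f\}\,(\mathrm{pr}_1\{\sigma\,s\,f\}\{g\circ\mathrm{pr}\}\,p)$; - $\mathrm{pr}_2\{f(\mathrm{pr}_1p)\}\{\lambda p'.g(\mathrm{pr}_1p,p')\}\,(\mathrm{pr}_2\{s\}\{h\}\,p)=\mathrm{pr}_2\{\sigma\,s\,f\}\{g\circ\mathrm{pr}\}\,p$, where $h:=\lambda p.\,\sigma\,(f\,p)\,(g\circ(p,-))$. **Distributive laws.** Let $(S\lhd P,\iota^S,\sigma^S,\mathrm{pr}^S)$ and $(T\lhd Q,\iota^T,\sigma^T,\mathrm{pr}^T)$ be monadic containers. A monadic container distributive law of $T\lhd Q$ over $S\lhd P$ consists of - $u_1:\prod_{s:S}(P\,s\to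 T)\to T$, - $u_2:\prod_{s:S}\prod_{f:P\,s\to T}Q\,(u_1\,s\,f)\to S$, - $v_1:\prod_{\{s:S\}}\prod_{\{f:P\,s\to T\}}\prod_{q:Q(u_1\,s\,f)}P\,(u_2\,s\,f\,q)\to P\,s$, - $v_2:\prod_{\{s:S\}}\prod_{\{f:P\,s\to T\}}\prod_{q:Q(u_1\,s\,f)}\prod_{p:P(u_2\,s\,f\,q)}Q\,(f\,(v_1\,q\,p))$, satisfying (with $v\,q:=\lambda p.(v_1\,q\,p,v_2\,q\,p)$), for all arguments of the appropriate types: - (unit-$\iota S$) $u_1\,\iota^S\,(\lambda\_.t)=t$; $u_2\,\iota^S\,(\lambda\_.t)=\lambda\_.\iota^S$; $v_1\{\iota^S\}\{\lambda\_.t\}\,q\,p=p$; $v_2\{\iota^S\}\{\lambda\_.t\}\,q\,p=q$; - (unit-$\iota T$) $u_1\,s\,(\lambda\_.\iota^T)=\iota^T$; $u_2\,s\,(\lambda\_.\iota^T)=\lambda\_.s$; $v_1\{s\}\{\lambda\_.\iota^T\}\,q\,p=p$; $v_2\{s\}\{\lambda\_.\iota^T\}\,q\,p=q$; - (mul-$S$) for $f:P\,s\to S$, $g:(\sum_{p:P\,s}P(f\,p))\to T$: $u_1(\sigma^S s\,f)(g\circ\mathrm{pr}^S)=u_1\,s\,(\lambda p.u_1(f\,p)(g\circ(p,-)))$; $u_2(\sigma^S s\,f)(g\circ\mathrm{pr}^S)\,q=\sigma^S\big(u_2\,s\,(\lambda p.u_1(f\,p)(g\circ(p,-)))\,q\big)\big(\lambda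 p.u_2(f(v_1\,q\,p))(g\circ(v_1\,q\,p,-))(v_2\,q\,p)\big)$; $\mathrm{pr}^S_1(v_1\,q\,p)=v_1\,q\,(\mathrm{pr}^S_1p)$; $\mathrm{pr}^S_2(v_1\,q\,p)=v_1(v_2\,q\,(\mathrm{pr}^S_1p))(\mathrm{pr}^S_2p)$; $v_2\,q\,p=v_2(v_2\,q\,(\mathrm{pr}^S_1p))(\mathrm{pr}^S_2p)$; - (mul-$T$) for $f:P\,s\to T$, $g:(\sum_{p:P\,s}Q(f\,p))\to T$: $u_1\,s\,(\lambda p.\sigma^T(f\,p)(g\circ(p,-)))=\sigma^T(u_1\,s\,f)(\lambda q.u_1(u_2\,s\,f\,q)(g\circ v\,q))$; $u_2\,s\,(\lambda p.\sigma^T(f\,p)(g\circ(p,-)))\,q=u_2(u_2\,s\,f\,(\mathrm{pr}^T_1q))(g\circ v\,(\mathrm{pr}^T_1 q))(\mathrm{pr}^T_2q)$; $v_1(\mathrm{pr}^T_1q)(v_1(\mathrm{pr}^T_2q)\,p)=v_1\,q\,p$; $v_2(\mathrm{pr}^T_1q)(v_1(\mathrm{pr}^T_2q)\,p)=\mathrm{pr}^T_1(v_2\,q\,p)$; $v_2(\mathrm{pr}^T_2q)\,p=\mathrm{pr}^T_2(v_2\,q\,p)$. **Constant shapes.** For a monadic container on $S\lhd P$, a shape $s:S$ is a constant shape if $P\,s\cong\bot$. **(S3) property.** A monadic container $(S\lhd P,\iota,\sigma,\mathrm{pr})$ satisfies (S3) for $s:S$ and $f:P\,s\to S$ if $P\,s$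 is non-empty, equality on $P\,s$ is decidable, and for every $p:P\,s$, $\sigma\,s\,f^p=\iota$ and $\mathrm{pr}_1\{s\}\{f^p\}\,p'=p$ for all $p':P(\sigma\,s\,f^p)$, where $f^p\,p':=\iota$ if $p=p'$ and $f^p\,p':=f\,p'$ otherwise. -}

module Defs where

open import Data.Bool.Base using (if_then_else_)
open import Data.Container.Core using (Container; Shape; Position)
open import Data.Empty using (⊥)
open import Data.Product.Base using (Σ-syntax; _,_; proj₁; proj₂)
open import Data.Product.Properties using (Σ-≡,≡→≡)
open import Function.Base using (_∘_)
open import Function.Bundles using (_↔_)
open import Level using (Level; suc)
open import Relation.Binary.Definitions using (DecidableEquality)
open import Relation.Binary.PropositionalEquality using (_≡_; subst)
open import Relation.Nullary.Decidable.Core using (does)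
open import Relation.Nullary.Negation.Core using (¬_)

-- Axiom K is in force, so every type in Set ℓ is an h-set and shapes and
-- positions need no truncation hypotheses.
--
-- An equality that only typechecks over earlier equalities is stated by
-- transporting one side along exactly those equalities.  When the dependency
-- is on a pair of positions, the two component equalities are combined with
-- Σ-≡,≡→≡.

record MonadicContainer (ℓ : Level) : Set (suc ℓ) where
  field
    container : Container ℓ ℓ

  open Container container public renaming (Shape to S; Position to P)

  field
    ι  : S
    σ  : (s : S) → (P s → S) → S
    pr : {s : S} {f : P s → S} → P (σ s f) → Σ[ p ∈ P s ] P (f p)

  pr₁ : {s : S} {f : P s → S} → P (σ s f) → P s
  pr₁ {s} {f} p = proj₁ (pr {s} {f} p)

  pr₂ : {s : S} {f : P s → S} (p : P (σ s f)) → P (f (pr₁ {s} {f} p))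
  pr₂ {s} {f} p = proj₂ (pr {s} {f} p)

  field
    σ-identityˡ   : (s : S) → σ ι (λ _ → s) ≡ s
    pr₂-identityˡ : (s : S) (p : P (σ ι (λ _ → s))) →
                    pr₂ {ι} {λ _ → s} p ≡ subst P (σ-identityˡ s) p

    σ-identityʳ   : (s : S) → σ s (λ _ → ι) ≡ s
    pr₁-identityʳ : (s : S) (p : P (σ s (λ _ → ι))) →
                    pr₁ {s} {λ _ → ι} p ≡ subst P (σ-identityʳ s) p

  nested : (s : S) (f : P s → S) → (Σ[ p ∈ P s ] P (f p) → S) → P s → S
  nested s f g p = σ (f p) (λ p′ → g (p , p′))

  flattened : (s : S) (f : P s → S) → (Σ[ p ∈ P s ] P (f p) → S) → P (σ s f) → S
  flattened s f g = g ∘ pr {s} {f}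

  field
    σ-assoc : (s : S) (f : P s → S) (g : (Σ[ p ∈ P s ] P (f p)) → S) →
              σ s (nested s f g) ≡ σ (σ s f) (flattened s f g)

    pr₁-assoc  : (s : S) (f : P s → S) (g : (Σ[ p ∈ P s ] P (f p)) → S)
                 (p : P (σ s (nested s f g))) →
                 let p′ = subst P (σ-assoc s f g) p in
                 pr₁ {s} {nested s f g} p
                 ≡ pr₁ {s} {f} (pr₁ {σ s f} {flattened s f g} p′)

    pr₁₂-assoc : (s : S) (f : P s → S) (g : (Σ[ p ∈ P s ] P (f p)) → S)
                 (p : P (σ s (nested s f g))) →
                 let p′ = subst P (σ-assoc s f g) p
                     p₁ = pr₁ {s} {nested s f g} p in
                 subst (P ∘ f) (pr₁-assoc s f g p)
                       (pr₁ {f p₁} {λ x → g (p₁ , x)} (pr₂ {s} {nested s f g} p))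
                 ≡ pr₂ {s} {f} (pr₁ {σ s f} {flattened s f g} p′)

    pr₂-assoc  : (s : S) (f : P s → S) (g : (Σ[ p ∈ P s ] P (f p)) → S)
                 (p : P (σ s (nested s f g))) →
                 let p′ = subst P (σ-assoc s f g) p
                     p₁ = pr₁ {s} {nested s f g} p in
                 subst (P ∘ g)
                       (Σ-≡,≡→≡ (pr₁-assoc s f g p , pr₁₂-assoc s f g p))
                       (pr₂ {f p₁} {λ x → g (p₁ , x)} (pr₂ {s} {nested s f g} p))
                 ≡ pr₂ {σ s f} {flattened s f g} p′

  IsConstantShape : S → Set ℓ
  IsConstantShape s = P s ↔ ⊥

  record S3 (s : S) (f : P s → S) : Set ℓ where
    field
      nonEmpty : ¬ IsConstantShape s
      _≟_      : DecidableEquality (P s)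

    _^_ : (P s → S) → P s → (P s → S)
    (h ^ p) p′ = if does (p ≟ p′) then ι else h p′

    field
      σ-^  : (p : P s) → σ s (f ^ p) ≡ ι
      pr₁-^ : (p : P s) (p′ : P (σ s (f ^ p))) → pr₁ {s} {f ^ p} p′ ≡ p

-- DistributiveLaw 𝕊 𝕋 is a distributive law of 𝕋 over 𝕊.
record DistributiveLaw {ℓ : Level} (𝕊 𝕋 : MonadicContainer ℓ) : Set ℓ where
  open MonadicContainer 𝕊 using (S; P) renaming
    (ι to ιS; σ to σS; pr to prS; pr₁ to prS₁; pr₂ to prS₂)
  open MonadicContainer 𝕋 using () renaming
    (S to T; P to Q; ι to ιT; σ to σT; pr to prT; pr₁ to prT₁; pr₂ to prT₂)

  field
    u₁ : (s : S) → (P s → T) → T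
    u₂ : (s : S) (f : P s → T) → Q (u₁ s f) → S
    v₁ : {s : S} {f : P s → T} (q : Q (u₁ s f)) → P (u₂ s f q) → P s
    v₂ : {s : S} {f : P s → T} (q : Q (u₁ s f)) (p : P (u₂ s f q)) →
         Q (f (v₁ {s} {f} q p))

  v : {s : S} {f : P s → T} (q : Q (u₁ s f)) → P (u₂ s f q) →
      Σ[ p ∈ P s ] Q (f p)
  v {s} {f} q p = v₁ {s} {f} q p , v₂ {s} {f} q p

  field
    u₁-ιS : (t : T) → u₁ ιS (λ _ → t) ≡ t
    u₂-ιS : (t : T) → u₂ ιS (λ _ → t) ≡ (λ _ → ιS)
    v₁-ιS : (t : T) (q : Q (u₁ ιS (λ _ → t))) (p : P (u₂ ιS (λ _ → t) q)) →
            v₁ {ιS} {λ _ → t} q p ≡ subst (λ k → P (k q)) (u₂-ιS t) p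
    v₂-ιS : (t : T) (q : Q (u₁ ιS (λ _ → t))) (p : P (u₂ ιS (λ _ → t) q)) →
            v₂ {ιS} {λ _ → t} q p ≡ subst Q (u₁-ιS t) q

    u₁-ιT : (s : S) → u₁ s (λ _ → ιT) ≡ ιT
    u₂-ιT : (s : S) → u₂ s (λ _ → ιT) ≡ (λ _ → s)
    v₁-ιT : (s : S) (q : Q (u₁ s (λ _ → ιT))) (p : P (u₂ s (λ _ → ιT) q)) →
            v₁ {s} {λ _ → ιT} q p ≡ subst (λ k → P (k q)) (u₂-ιT s) p
    v₂-ιT : (s : S) (q : Q (u₁ s (λ _ → ιT))) (p : P (u₂ s (λ _ → ιT) q)) →
            v₂ {s} {λ _ → ιT} q p ≡ subst Q (u₁-ιT s) q

  flattenedS : (s : S) (f : P s → S) → (Σ[ p ∈ P s ] P (f p) → T) →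
               P (σS s f) → T
  flattenedS s f g = g ∘ prS {s} {f}

  innerU₁ : (s : S) (f : P s → S) → (Σ[ p ∈ P s ] P (f p) → T) → P s → T
  innerU₁ s f g p = u₁ (f p) (λ p′ → g (p , p′))

  innerU₂ : (s : S) (f : P s → S) (g : (Σ[ p ∈ P s ] P (f p)) → T)
            (q : Q (u₁ s (innerU₁ s f g))) → P (u₂ s (innerU₁ s f g) q) → S
  innerU₂ s f g q p =
    let p₁ = v₁ {s} {innerU₁ s f g} q p in
    u₂ (f p₁) (λ p′ → g (p₁ , p′)) (v₂ {s} {innerU₁ s f g} q p)

  field
    u₁-σS : (s : S) (f : P s → S) (g : (Σ[ p ∈ P s ] P (f p)) → T) →
            u₁ (σS s f) (flattenedS s f g) ≡ u₁ s (innerU₁ s f g)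

    u₂-σS : (s : S) (f : P s → S) (g : (Σ[ p ∈ P s ] P (f p)) → T)
            (q : Q (u₁ (σS s f) (flattenedS s f g))) →
            let q′ = subst Q (u₁-σS s f g) q in
            u₂ (σS s f) (flattenedS s f g) q
            ≡ σS (u₂ s (innerU₁ s f g) q′) (innerU₂ s f g q′)

    prS₁-v₁ : (s : S) (f : P s → S) (g : (Σ[ p ∈ P s ] P (f p)) → T)
              (q : Q (u₁ (σS s f) (flattenedS s f g)))
              (p : P (u₂ (σS s f) (flattenedS s f g) q)) →
              let q′ = subst Q (u₁-σS s f g) q
                  p′ = subst P (u₂-σS s f g q) p in
              prS₁ {s} {f} (v₁ {σS s f} {flattenedS s f g} q p)
              ≡ v₁ {s} {innerU₁ s f g} q′ (prS₁ {f = innerU₂ s f g q′} p′)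

    prS₂-v₁ : (s : S) (f : P s → S) (g : (Σ[ p ∈ P s ] P (f p)) → T)
              (q : Q (u₁ (σS s f) (flattenedS s f g)))
              (p : P (u₂ (σS s f) (flattenedS s f g) q)) →
              let q′ = subst Q (u₁-σS s f g) q
                  p′ = subst P (u₂-σS s f g q) p
                  p₁ = prS₁ {f = innerU₂ s f g q′} p′
                  p₂ = prS₂ {f = innerU₂ s f g q′} p′
                  r  = v₁ {s} {innerU₁ s f g} q′ p₁ in
              subst (P ∘ f) (prS₁-v₁ s f g q p)
                    (prS₂ {s} {f} (v₁ {σS s f} {flattenedS s f g} q p))
              ≡ v₁ {f r} {λ x → g (r , x)} (v₂ {s} {innerU₁ s f g} q′ p₁) p₂

    v₂-σS : (s : S) (f : P s → S) (g : (Σ[ p ∈ P s ] P (f p)) → T)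
            (q : Q (u₁ (σS s f) (flattenedS s f g)))
            (p : P (u₂ (σS s f) (flattenedS s f g) q)) →
            let q′ = subst Q (u₁-σS s f g) q
                p′ = subst P (u₂-σS s f g q) p
                p₁ = prS₁ {f = innerU₂ s f g q′} p′
                p₂ = prS₂ {f = innerU₂ s f g q′} p′
                r  = v₁ {s} {innerU₁ s f g} q′ p₁ in
            subst (Q ∘ g)
                  (Σ-≡,≡→≡ (prS₁-v₁ s f g q p , prS₂-v₁ s f g q p))
                  (v₂ {σS s f} {flattenedS s f g} q p)
            ≡ v₂ {f r} {λ x → g (r , x)} (v₂ {s} {innerU₁ s f g} q′ p₁) p₂

  nestedT : (s : S) (f : P s → T) → (Σ[ p ∈ P s ] Q (f p) → T) → P s → T
  nestedT s f g p = σT (f p) (λ q → g (p , q))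

  outerU₁ : (s : S) (f : P s → T) → (Σ[ p ∈ P s ] Q (f p) → T) →
            Q (u₁ s f) → T
  outerU₁ s f g q = u₁ (u₂ s f q) (g ∘ v {s} {f} q)

  field
    u₁-σT : (s : S) (f : P s → T) (g : (Σ[ p ∈ P s ] Q (f p)) → T) →
            u₁ s (nestedT s f g) ≡ σT (u₁ s f) (outerU₁ s f g)

    u₂-σT : (s : S) (f : P s → T) (g : (Σ[ p ∈ P s ] Q (f p)) → T)
            (q : Q (u₁ s (nestedT s f g))) →
            let q′ = subst Q (u₁-σT s f g) q
                q₁ = prT₁ {f = outerU₁ s f g} q′
                q₂ = prT₂ {f = outerU₁ s f g} q′ in
            u₂ s (nestedT s f g) q ≡ u₂ (u₂ s f q₁) (g ∘ v {s} {f} q₁) q₂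

    v₁-σT : (s : S) (f : P s → T) (g : (Σ[ p ∈ P s ] Q (f p)) → T)
            (q : Q (u₁ s (nestedT s f g))) (p : P (u₂ s (nestedT s f g) q)) →
            let q′ = subst Q (u₁-σT s f g) q
                q₁ = prT₁ {f = outerU₁ s f g} q′
                q₂ = prT₂ {f = outerU₁ s f g} q′
                p′ = subst P (u₂-σT s f g q) p in
            v₁ {s} {f} q₁ (v₁ {u₂ s f q₁} {g ∘ v {s} {f} q₁} q₂ p′)
            ≡ v₁ {s} {nestedT s f g} q p

    prT₁-v₂ : (s : S) (f : P s → T) (g : (Σ[ p ∈ P s ] Q (f p)) → T)
              (q : Q (u₁ s (nestedT s f g))) (p : P (u₂ s (nestedT s f g) q)) →
              let q′ = subst Q (u₁-σT s f g) q
                  q₁ = prT₁ {f = outerU₁ s f g} q′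
                  q₂ = prT₂ {f = outerU₁ s f g} q′
                  p′ = subst P (u₂-σT s f g q) p
                  r  = v₁ {s} {nestedT s f g} q p in
              subst (Q ∘ f) (v₁-σT s f g q p)
                    (v₂ {s} {f} q₁ (v₁ {u₂ s f q₁} {g ∘ v {s} {f} q₁} q₂ p′))
              ≡ prT₁ {f r} {λ x → g (r , x)} (v₂ {s} {nestedT s f g} q p)

    prT₂-v₂ : (s : S) (f : P s → T) (g : (Σ[ p ∈ P s ] Q (f p)) → T)
              (q : Q (u₁ s (nestedT s f g))) (p : P (u₂ s (nestedT s f g) q)) →
              let q′ = subst Q (u₁-σT s f g) q
                  q₁ = prT₁ {f = outerU₁ s f g} q′
                  q₂ = prT₂ {f = outerU₁ s f g} q′
                  p′ = subst P (u₂-σT s f g q) p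
                  r  = v₁ {s} {nestedT s f g} q p in
              subst (Q ∘ g)
                    (Σ-≡,≡→≡ (v₁-σT s f g q p , prT₁-v₂ s f g q p))
                    (v₂ {u₂ s f q₁} {g ∘ v {s} {f} q₁} q₂ p′)
              ≡ prT₂ {f r} {λ x → g (r , x)} (v₂ {s} {nestedT s f g} q p)

{-# OPTIONS --safe #-}

-- Write ιT[p ↦ t] for the family P s → T with value t at p and ιT elsewhere.
-- Since σ s (f ^ p) = ι projects every position to p, the law mul-S together
-- with the unit laws gives u₁ s ιT[p ↦ t] = t.  If t is a constant shape and
-- h p = t, then h arises by grafting h onto ιT[p ↦ t], so mul-T gives
-- u₁ s h = σ t _ = t.  A family with values t₀ at p and t₁ at p′ then forces
-- t₀ = u₁ s h = t₁.

module Submission where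

open import Axiom.Extensionality.Propositional using (Extensionality)
open import Data.Bool.Base using (Bool; true; false; if_then_else_)
open import Data.Empty using (⊥-elim)
open import Data.Product using (∃₂; _×_; _,_; proj₁)
open import Function.Bundles using (Inverse)
open import Level using (Level)
open import Relation.Binary.PropositionalEquality
  using (_≡_; _≢_; refl; sym; trans; cong; subst; module ≡-Reasoning)
open import Relation.Nullary using (¬_; yes; no; does)
open import Relation.Nullary.Decidable using (dec-true; dec-false)
open import Defs

module _ {ℓ : Level} (ext : Extensionality ℓ ℓ) where

  -- Since `P t` is empty, `g` equals the family constantly `ι`, and the right unit law applies.
  σ-constantShape : (𝕋 : MonadicContainer ℓ) → let open MonadicContainer 𝕋 in
                    {t : S} → IsConstantShape t → (g : P t → S) → σ t g ≡ t
  σ-constantShape 𝕋 {t} t-const g =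
    trans (cong (σ t) (ext λ q → ⊥-elim (Inverse.to t-const q))) (σ-identityʳ t)
    where open MonadicContainer 𝕋

  module _ {𝕊 𝕋 : MonadicContainer ℓ} (law : DistributiveLaw 𝕊 𝕋) where
    open MonadicContainer 𝕊 using (S; P; S3)
      renaming (ι to ιS; σ to σS; pr₁ to prS₁)
    open MonadicContainer 𝕋 using (IsConstantShape)
      renaming (S to T; ι to ιT; σ to σT; σ-identityˡ to σT-identityˡ)
    open DistributiveLaw law

    -- One Boolean governs both the shape and the value, so each case is a unit law. With
    -- `does (p ≟ q)` for `b`, this evaluates the inner families in mul-S at every position `q`.
    u₁-if : (b : Bool) (r : S) (t : T) →
            u₁ (if b then ιS else r) (λ _ → if b then t else ιT)
            ≡ (if b then t else ιT)
    u₁-if true  r t = u₁-ιS t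
    u₁-if false r t = u₁-ιT r

    module _ {s : S} {f : P s → S} (s3 : S3 s f) where
      open S3 s3
      open ≡-Reasoning

      ιT[_↦_] : P s → T → P s → T
      ιT[ p ↦ t ] q = if does (p ≟ q) then t else ιT

      ιT[↦]-updates : (p : P s) (t : T) → ιT[ p ↦ t ] p ≡ t
      ιT[↦]-updates p t =
        cong (λ b → if b then t else ιT) (dec-true (p ≟ p) refl)

      u₁-ιT[↦] : (p : P s) (t : T) → u₁ s ιT[ p ↦ t ] ≡ t
      u₁-ιT[↦] p t = begin
        u₁ s ιT[ p ↦ t ]
          ≡⟨ cong (u₁ s) (ext λ q → u₁-if (does (p ≟ q)) (f q) t) ⟨
        u₁ s (innerU₁ s (f ^ p) g)
          ≡⟨ u₁-σS s (f ^ p) g ⟨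
        u₁ (σS s (f ^ p)) (flattenedS s (f ^ p) g)
          ≡⟨ cong (u₁ (σS s (f ^ p))) (ext flattened-const) ⟩
        u₁ (σS s (f ^ p)) (λ _ → t)
          -- A constant family makes sense over every shape, so the shape can now be rewritten
          -- without transport.
          ≡⟨ cong (λ r → u₁ r (λ _ → t)) (σ-^ p) ⟩
        u₁ ιS (λ _ → t)
          ≡⟨ u₁-ιS t ⟩
        t ∎
        where
        -- Ignoring the second component makes each inner family constant, as the unit laws require.
        g = λ x → ιT[ p ↦ t ] (proj₁ x)

        flattened-const : ∀ x → flattenedS s (f ^ p) g x ≡ t
        flattened-const x =
          trans (cong ιT[ p ↦ t ] (pr₁-^ p x)) (ιT[↦]-updates p t)

      u₁-constantShape : (h : P s → T) (p : P s) →
                         IsConstantShape (h p) → u₁ s h ≡ h p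
      u₁-constantShape h p hp-const = begin
        u₁ s h
          ≡⟨ cong (u₁ s) (ext graft) ⟨
        u₁ s (nestedT s ιT[ p ↦ h p ] g)
          ≡⟨ u₁-σT s ιT[ p ↦ h p ] g ⟩
        σT (u₁ s ιT[ p ↦ h p ]) (outerU₁ s ιT[ p ↦ h p ] g)
          -- The outer shape equals `h p`, so it has no positions and the values of `outerU₁` are
          -- irrelevant.
          ≡⟨ σ-constantShape 𝕋 (subst IsConstantShape (sym (u₁-ιT[↦] p (h p))) hp-const) _ ⟩
        u₁ s ιT[ p ↦ h p ]
          ≡⟨ u₁-ιT[↦] p (h p) ⟩
        h p ∎
        where
        g = λ x → h (proj₁ x)

        -- At `p` the shape `h p` has no positions and absorbs what is grafted; elsewhere the left
        -- unit law returns `h q`.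
        graft : ∀ q → σT (ιT[ p ↦ h p ] q) (λ _ → h q) ≡ h q
        graft q with p ≟ q
        ... | yes refl = σ-constantShape 𝕋 hp-const _
        ... | no  _    = σT-identityˡ (h q)

theorem35 : {ℓ : Level} → Extensionality ℓ ℓ →
    (𝕊 𝕋 : MonadicContainer ℓ) →
    (s : MonadicContainer.S 𝕊) (f : MonadicContainer.P 𝕊 s → MonadicContainer.S 𝕊) →
    MonadicContainer.S3 𝕊 s f →
    (p p′ : MonadicContainer.P 𝕊 s) → p ≢ p′ →
    DistributiveLaw 𝕊 𝕋 →
    ¬ (∃₂ λ (t₀ t₁ : MonadicContainer.S 𝕋) →
    MonadicContainer.IsConstantShape 𝕋 t₀ ×
    MonadicContainer.IsConstantShape 𝕋 t₁ × t₀ ≢ t₁)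
theorem35 ext 𝕊 𝕋 s f s3 p p′ p≢p′ law (t₀ , t₁ , t₀-const , t₁-const , t₀≢t₁) =
  t₀≢t₁ (begin
    t₀     ≡⟨ h-p ⟨
    h p    ≡⟨ u₁-constantShape ext law s3 h p (subst IsConstantShape (sym h-p) t₀-const) ⟨
    u₁ s h ≡⟨ u₁-constantShape ext law s3 h p′ (subst IsConstantShape (sym h-p′) t₁-const) ⟩
    h p′   ≡⟨ h-p′ ⟩
    t₁     ∎)
  where
  open MonadicContainer 𝕊 using (P; module S3)
  open MonadicContainer 𝕋 using (IsConstantShape) renaming (S to T)
  open S3 s3 using (_≟_)
  open DistributiveLaw law using (u₁)
  open ≡-Reasoning

  -- Only the values at `p` and `p′` matter; a decidable test against `p` alone separates them
  -- because `p ≢ p′`.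
  h : P s → T
  h q = if does (p ≟ q) then t₀ else t₁

  h-p : h p ≡ t₀
  h-p = cong (λ b → if b then t₀ else t₁) (dec-true (p ≟ p) refl)

  h-p′ : h p′ ≡ t₁
  h-p′ = cong (λ b → if b then t₀ else t₁) (dec-false (p ≟ p′) p≢p′)
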